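{- For $1\le i\le k$ let $G_i$ be an $r_i$-regular graph with $n_i\ge 2$ vertices and let $A_i$ be an Abelian group of order $n_i$; put $r=\sum_{i=1}^k r_i$. Suppose $\{1,\ldots,k\}$ is partitioned into three (possibly empty) sets $I,J,L$ such that: (a) for each $i\in I$, $G_i$ is $A_i$-distance magic and $\gcd(r-r_i,n_i)=1$; (b) for each $j\in J$, $G_j$ is $A_j$-distance antimagic and $\exp(A_j)$ divides $r-r_j$; (c) for each $l\in L$, $G_l$ admits an $A_l$-balanced labelling and $\gcd(r,n_l)=1$. Then $G_1\Box\cdots\Box G_k$ is $A_1\times\cdots\times A_k$-distance antimagic.
   Context: The Cartesian product $G_1\Box\cdots\Box G_k$ has vertex set $V(G_1)\times\cdots\times V(G_k)$, with $(x_1,\ldots,x_k)$ and $(y_1,\ldots,y_k)$ adjacent iff they differ in exactly one coordinate $i$ and $x_iy_i\in E(G_i)$. $\exp(A)$ is the least positive integer $m$ with $mx=0$ for all $x\in A$. For a graph $G$ with $n$ vertices and an Abelian group $A$ of order $n$ (written additively), and a bijection $f:V(G)\to A$, the weight of $x$ is $w_f(x)=\sum_{y\in N(x)} f(y)$ computed in $A$ ($N(x)$ the open neighbourhood). $f$ is an $A$-distance antimagic labelling if all weights are pairwise distinct, and an $A$-distance magic labelling if all weights are equal. $G$ is $A$-distance antimagic (resp. magic) if it admits such a labelling. If $G$ is $r$-regular, a bijection $f:V(G)\to A$ is an $A$-balanced labelling if $w_f(x)=r f(x)$ for every $x\in V(G)$. -}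

module Defs where

open import Algebra.Bundles using (AbelianGroup)
import Algebra.Definitions.RawMonoid as RawMonoidDefs
import Algebra.Properties.CommutativeMonoid.Sum as Sum
open import Data.Fin.Base using (Fin; zero; suc; combine; remQuot)
open import Data.Fin.Properties using (_≟_; any?; all?; combine-remQuot; remQuot-combine)
open import Data.Fin.Subset using (Subset; _∈_; _∩_; Empty)
open import Data.List.Base using (List; foldr; map; filter; length; tabulate)
open import Data.Nat.Base using (ℕ; zero; suc; _≤_; _<_)
open import Data.Nat.Properties using (+-0-commutativeMonoid; *-1-commutativeMonoid)
open import Data.Product.Base using (_×_; _,_; ∃-syntax; proj₁; proj₂)
open import Data.Sum.Base using (_⊎_)
open import Function.Base using (_∘_)
open import Function.Bundles using (Inverse; Bijection)
open import Function.Definitions using (Injective)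
open import Function.Properties.Inverse using (Inverse⇒Injection)
open import Level using (Level; _⊔_) renaming (suc to lsuc)
open import Relation.Binary.Bundles using (Setoid)
open import Relation.Binary.Definitions using (Decidable; Symmetric; Irreflexive; _Respects₂_)
open import Relation.Binary.PropositionalEquality as ≡ using (_≡_; _≢_)
open import Relation.Nullary.Decidable using (_×-dec_; _→-dec_; ¬?; via-injection)
open import Relation.Nullary.Negation using (¬_)

private
  variable
    v ℓ e a b : Level

∑ ∏ : ∀ {k} → (Fin k → ℕ) → ℕ
∑ = Sum.sum +-0-commutativeMonoid
∏ = Sum.sum *-1-commutativeMonoid

HasCardinality : Setoid v ℓ → ℕ → Set (v ⊔ ℓ)
HasCardinality S n = Inverse S (≡.setoid (Fin n))

-- The vertices form a setoid rather than a plain type, because the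
-- vertices of a k-fold product are functions on Fin k, which can only
-- be compared pointwise.

record Graph v ℓ e : Set (lsuc (v ⊔ ℓ ⊔ e)) where
  infix 4 _~_
  field
    vertices    : Setoid v ℓ
    order       : ℕ
    enumeration : HasCardinality vertices order

  open Setoid vertices public using (_≈_) renaming (Carrier to V)

  field
    _~_      : V → V → Set e
    _~?_     : Decidable _~_
    ~-resp-≈ : _~_ Respects₂ _≈_
    ~-sym    : Symmetric _~_
    ~-irrefl : Irreflexive _≈_ _~_

  allVertices : List V
  allVertices = tabulate (Inverse.from enumeration)

  -- Lists each vertex of the open neighbourhood exactly once.
  N : V → List V
  N x = filter (x ~?_) allVertices

  degree : V → ℕ
  degree x = length (N x)

Regular : Graph v ℓ e → ℕ → Set v
Regular G r = ∀ x → degree x ≡ r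
  where open Graph G

∏ₛ : ∀ {k} → (Fin k → Setoid v ℓ) → Setoid v ℓ
∏ₛ {k = k} S = record
  { Carrier       = (i : Fin k) → S.Carrier i
  ; _≈_           = λ x y → ∀ i → S._≈_ i (x i) (y i)
  ; isEquivalence = record
    { refl  = λ i → S.refl i
    ; sym   = λ p i → S.sym i (p i)
    ; trans = λ p q i → S.trans i (p i) (q i)
    }
  }
  where module S i = Setoid (S i)

∏ₛ-cardinality : ∀ {k} (S : Fin k → Setoid v ℓ) (n : Fin k → ℕ) →
                 (∀ i → HasCardinality (S i) (n i)) →
                 HasCardinality (∏ₛ S) (∏ n)
∏ₛ-cardinality {k = zero} S n h = record
  { to        = λ _ → zero
  ; from      = λ _ ()
  ; to-cong   = λ _ → ≡.refl
  ; from-cong = λ _ ()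
  ; inverse   = (λ { {zero} _ → ≡.refl }) , λ _ ()
  }
∏ₛ-cardinality {k = suc k} S n h = record
  { to        = to
  ; from      = from
  ; to-cong   = λ p → ≡.cong₂ combine (H.to-cong (p zero)) (T.to-cong (p ∘ suc))
  ; from-cong = from-cong
  ; inverse   =
      (λ {j} p → ≡.trans
        (≡.cong₂ combine (H.inverseˡ (p zero)) (T.inverseˡ (p ∘ suc)))
        (combine-remQuot {n zero} rest j))
    , λ { {x} ≡.refl zero    → H.inverseʳ (≡.cong proj₁ (split x))
        ; {x} ≡.refl (suc i) → T.inverseʳ (≡.cong proj₂ (split x)) i
        }
  }
  where
  module H = Inverse (h zero)
  module T = Inverse (∏ₛ-cardinality (S ∘ suc) (n ∘ suc) (h ∘ suc))

  rest : ℕ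
  rest = ∏ (n ∘ suc)

  to : Setoid.Carrier (∏ₛ S) → Fin (∏ n)
  to x = combine (H.to (x zero)) (T.to (x ∘ suc))

  from : Fin (∏ n) → Setoid.Carrier (∏ₛ S)
  from j zero    = H.from (proj₁ (remQuot {n zero} rest j))
  from j (suc i) = T.from (proj₂ (remQuot {n zero} rest j)) i

  from-cong : ∀ {j j′} → j ≡ j′ → Setoid._≈_ (∏ₛ S) (from j) (from j′)
  from-cong ≡.refl i = Setoid.refl (S i)

  split : ∀ x → remQuot {n zero} rest (to x) ≡ (H.to (x zero) , T.to (x ∘ suc))
  split x = remQuot-combine (H.to (x zero)) (T.to (x ∘ suc))

∏ᴳ : ∀ {k} → (Fin k → AbelianGroup a b) → AbelianGroup a b
∏ᴳ {k = k} A = record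
  { Carrier        = (i : Fin k) → A.Carrier i
  ; _≈_            = λ x y → ∀ i → A._≈_ i (x i) (y i)
  ; _∙_            = λ x y i → A._∙_ i (x i) (y i)
  ; ε              = λ i → A.ε i
  ; _⁻¹            = λ x i → A._⁻¹ i (x i)
  ; isAbelianGroup = record
    { isGroup = record
      { isMonoid = record
        { isSemigroup = record
          { isMagma = record
            { isEquivalence = Setoid.isEquivalence (∏ₛ (λ i → A.setoid i))
            ; ∙-cong        = λ p q i → A.∙-cong i (p i) (q i)
            }
          ; assoc = λ x y z i → A.assoc i (x i) (y i) (z i)
          }
        ; identity = (λ x i → A.identityˡ i (x i)) , λ x i → A.identityʳ i (x i)
        }
      ; inverse = (λ x i → A.inverseˡ i (x i)) , λ x i → A.inverseʳ i (x i)
      ; ⁻¹-cong = λ p i → A.⁻¹-cong i (p i)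
      }
    ; comm = λ x y i → A.comm i (x i) (y i)
    }
  }
  where module A i = AbelianGroup (A i)

□ : ∀ {k} → (Fin k → Graph v ℓ e) → Graph v ℓ (ℓ ⊔ e)
□ {v = v} {ℓ = ℓ} {e = e} {k = k} G = record
  { vertices    = ∏ₛ (λ i → G.vertices i)
  ; order       = ∏ (λ i → G.order i)
  ; enumeration = ∏ₛ-cardinality (λ i → G.vertices i) (λ i → G.order i) (λ i → G.enumeration i)
  ; _~_         = Adjacent
  ; _~?_        = λ x y → any? λ i →
      (¬? (≈? i (x i) (y i)) ×-dec all? λ j → ¬? (j ≟ i) →-dec ≈? j (x j) (y j))
      ×-dec G._~?_ i (x i) (y i)
  ; ~-resp-≈    =
      (λ { p (i , (d , s) , xy) →
           i , ( (λ q → d (S.trans i q (S.sym i (p i))))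
               , λ j j≢i → S.trans j (s j j≢i) (p j))
             , proj₁ (G.~-resp-≈ i) (p i) xy })
    , (λ { p (i , (d , s) , xy) →
           i , ( (λ q → d (S.trans i (p i) q))
               , λ j j≢i → S.trans j (S.sym j (p j)) (s j j≢i))
             , proj₂ (G.~-resp-≈ i) (p i) xy })
  ; ~-sym       = λ { (i , (d , s) , xy) →
      i , ((λ q → d (S.sym i q)) , λ j j≢i → S.sym j (s j j≢i)) , G.~-sym i xy }
  ; ~-irrefl    = λ { p (i , _ , xy) → G.~-irrefl i (p i) xy }
  }
  where
  module G i = Graph (G i)
  module S i = Setoid (G.vertices i)

  DifferExactlyAt : Fin k → ((i : Fin k) → G.V i) → ((i : Fin k) → G.V i) → Set ℓ
  DifferExactlyAt i x y =
    (¬ G._≈_ i (x i) (y i)) × (∀ j → j ≢ i → G._≈_ j (x j) (y j))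

  Adjacent : ((i : Fin k) → G.V i) → ((i : Fin k) → G.V i) → Set (ℓ ⊔ e)
  Adjacent x y = ∃[ i ] DifferExactlyAt i x y × G._~_ i (x i) (y i)

  ≈? : ∀ i → Decidable (G._≈_ i)
  ≈? i = via-injection (Inverse⇒Injection (G.enumeration i)) _≟_

module _ (A : AbelianGroup a b) where

  open AbelianGroup A

  HasOrder : ℕ → Set (a ⊔ b)
  HasOrder = HasCardinality setoid

  _·_ : ℕ → Carrier → Carrier
  _·_ = RawMonoidDefs._×_ rawMonoid

  Annihilates : ℕ → Set (a ⊔ b)
  Annihilates m = ∀ x → (m · x) ≈ ε

  -- exp(A) as a relation, since an infinite A may have no exponent.
  IsExp : ℕ → Set (a ⊔ b)
  IsExp m = (0 < m × Annihilates m) × (∀ m′ → 0 < m′ → Annihilates m′ → m ≤ m′)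

module _ (G : Graph v ℓ e) (A : AbelianGroup a b) where

  open Graph G using (V; N; vertices) renaming (_≈_ to _≈ᵛ_)
  open AbelianGroup A

  -- A bijection V(G) → A exists only if A has order |V(G)|.
  Labelling : Set (v ⊔ ℓ ⊔ a ⊔ b)
  Labelling = Bijection vertices setoid

  weight : Labelling → V → Carrier
  weight f x = foldr _∙_ ε (map (Bijection.to f) (N x))

  IsDistanceMagic : Labelling → Set (v ⊔ b)
  IsDistanceMagic f = ∀ x y → weight f x ≈ weight f y

  IsDistanceAntimagic : Labelling → Set (v ⊔ ℓ ⊔ b)
  IsDistanceAntimagic f = Injective _≈ᵛ_ _≈_ (weight f)

  -- Only meaningful when G is r-regular.
  IsBalanced : ℕ → Labelling → Set (v ⊔ b)
  IsBalanced r f = ∀ x → weight f x ≈ _·_ A r (Bijection.to f x)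

  DistanceMagic DistanceAntimagic : Set (v ⊔ ℓ ⊔ a ⊔ b)
  DistanceMagic     = ∃[ f ] IsDistanceMagic f
  DistanceAntimagic = ∃[ f ] IsDistanceAntimagic f

  HasBalancedLabelling : ℕ → Set (v ⊔ ℓ ⊔ a ⊔ b)
  HasBalancedLabelling r = ∃[ f ] IsBalanced r f

record IsPartition {k} (I J L : Subset k) : Set where
  field
    cover       : ∀ i → i ∈ I ⊎ i ∈ J ⊎ i ∈ L
    disjoint-IJ : Empty (I ∩ J)
    disjoint-IL : Empty (I ∩ L)
    disjoint-JL : Empty (J ∩ L)

{-# OPTIONS --safe #-}

-- In the product labelling x ↦ (fᵢ xᵢ)ᵢ, the neighbours of x obtained by
-- moving coordinate i contribute w(xᵢ) to the i-th component of the weight of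
-- x, and each of the ∑ r ∸ rᵢ other neighbours contributes fᵢ xᵢ.  So the
-- i-th component is w(xᵢ) + (∑ r ∸ rᵢ) fᵢ xᵢ, and under each of (a), (b), (c)
-- this determines xᵢ: multiplication by a number coprime to nᵢ is injective
-- on Aᵢ, because nᵢ annihilates Aᵢ.

module Submission where

open import Defs
open import Algebra.Bundles using (AbelianGroup; CommutativeMonoid)
import Algebra.Properties.CommutativeMonoid.Mult as Mult
import Algebra.Properties.CommutativeMonoid.Sum as Sum
import Algebra.Properties.CommutativeSemigroup as CommutativeSemigroupProperties
import Algebra.Properties.Group as GroupProperties
open import Data.Bool.Base using (true; false; if_then_else_)
open import Data.Empty using (⊥-elim)
open import Data.Fin.Base using (Fin; zero; suc; combine; _↑ˡ_; _↑ʳ_)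
open import Data.Fin.Permutation using (permutation)
open import Data.Fin.Properties using (_≟_; suc-injective; remQuot-combine; ∀-cons)
open import Data.Fin.Subset using (Subset; _∈_)
open import Data.List.Base using (List; []; _∷_; foldr; map; filter; length; tabulate)
open import Data.Nat.Base using (ℕ; zero; suc; _+_; _*_; _≤_; _∸_)
open import Data.Nat.Divisibility using (_∣_; divides)
open import Data.Nat.GCD using (gcd; GCD; gcd-GCD; module Bézout)
open import Data.Nat.Properties
  using (+-0-commutativeMonoid; *-comm; m≤m+n; m≤n⇒m≤o+n; m∸n+n≡m; m+[n∸m]≡n)
open import Data.Product.Base using (_×_; _,_; ∃-syntax; proj₁; proj₂)
open import Data.Sum.Base using (_⊎_; inj₁; inj₂; [_,_]′)
open import Function.Base using (_∘_; const)
open import Function.Bundles using (Inverse; Bijection; _⇔_; mk⇔; Equivalence)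
open import Function.Definitions using (Injective)
open import Function.Properties.Inverse using (Inverse⇒Injection)
open import Level using (Level; _⊔_)
open import Relation.Binary.Bundles using (Setoid)
open import Relation.Binary.Definitions using (Decidable)
open import Relation.Binary.PropositionalEquality as ≡ using (_≡_)
import Relation.Binary.Reasoning.Setoid as SetoidReasoning
open import Relation.Nullary.Decidable using (Dec; yes; no; does; _×-dec_; via-injection)
open import Relation.Nullary.Negation using (¬_; contradiction)

private
  variable
    v ℓ e a b p q : Level
    n : ℕ

_≈?_ : {S : Setoid v ℓ} → HasCardinality S n → Decidable (Setoid._≈_ S)
_≈?_ h = via-injection (Inverse⇒Injection h) _≟_

-- Adjacency in a product with its first factor split off.

module Adjacency {k} (G : Fin (suc k) → Graph v ℓ e) where

  private
    module P = Graph (□ G)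
    module H = Graph (G zero)
    module T = Graph (□ (G ∘ suc))

  -- The single changed coordinate is either the first or a later one. This is the recursion on the
  -- number of factors that every sum over a neighbourhood in `□ G` follows below.
  □-adjacent : ∀ {x y} →
    (x P.~ y) ⇔ ((x zero H.~ y zero × (x ∘ suc) T.≈ (y ∘ suc)) ⊎
                 (x zero H.≈ y zero × (x ∘ suc) T.~ (y ∘ suc)))
  □-adjacent = mk⇔
    (λ { (zero , (_ , s) , xy) → inj₁ (xy , λ j → s (suc j) λ ())
       ; (suc i , (d , s) , xy) →
           inj₂ (s zero (λ ()) , i , (d , λ j j≢i → s (suc j) (j≢i ∘ suc-injective)) , xy) })
    λ { (inj₁ (xy , s)) →
          -- `DifferExactlyAt` also asks that the heads be distinct; adjacent heads are, by
          -- irreflexivity.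
          zero , ((λ eq → H.~-irrefl eq xy)
                 , λ { zero j≢0 → ⊥-elim (j≢0 ≡.refl) ; (suc j) _ → s j })
               , xy
      ; (inj₂ (eq , i , (d , s) , xy)) →
          suc i , (d , λ { zero _ → eq ; (suc j) j≢i → s j (j≢i ∘ ≡.cong suc) }) , xy }

-- Finite sums with brackets in a commutative monoid.

module Summation (M : CommutativeMonoid a b) where

  open CommutativeMonoid M
  open Sum M using (sum; sum-cong-≋; sum-replicate-zero; ∑-distrib-+)
  open Mult M using () renaming (_×_ to _⋆_)
  open SetoidReasoning setoid

  infix 9 [_]_

  -- Iverson bracket.
  [_]_ : {P : Set p} → Dec P → Carrier → Carrier
  [ p? ] x = if does p? then x else ε

  []-cong : {P : Set p} {Q : Set q} → P ⇔ Q → (p? : Dec P) (q? : Dec Q) →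
            ∀ {x y} → x ≈ y → [ p? ] x ≈ [ q? ] y
  []-cong P⇔Q (yes p) (yes q) x≈y = x≈y
  []-cong P⇔Q (yes p) (no ¬q) x≈y = contradiction (Equivalence.to P⇔Q p) ¬q
  []-cong P⇔Q (no ¬p) (yes q) x≈y = contradiction (Equivalence.from P⇔Q q) ¬p
  []-cong P⇔Q (no ¬p) (no ¬q) x≈y = refl

  []-congʳ : {P : Set p} (p? : Dec P) → ∀ {x y} → (P → x ≈ y) → [ p? ] x ≈ [ p? ] y
  []-congʳ (yes p) x≈y = x≈y p
  []-congʳ (no ¬p) x≈y = refl

  []-× : {P : Set p} {Q : Set q} (p? : Dec P) (q? : Dec Q) →
         ∀ x → [ p? ×-dec q? ] x ≈ [ p? ] [ q? ] x
  []-× (yes p) q? x = refl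
  []-× (no ¬p) q? x = refl

  -- Exclusivity of `Q` and `R` keeps `x` from being counted twice.
  []-⊎ : {P : Set p} {Q : Set q} {R : Set e} → P ⇔ (Q ⊎ R) → ¬ (Q × R) →
         (p? : Dec P) (q? : Dec Q) (r? : Dec R) → ∀ x → [ p? ] x ≈ [ q? ] x ∙ [ r? ] x
  []-⊎ P⇔ ¬QR p? (yes q) (yes r) x = contradiction (q , r) ¬QR
  []-⊎ P⇔ ¬QR (yes p) (yes q) (no ¬r) x = sym (identityʳ x)
  []-⊎ P⇔ ¬QR (no ¬p) (yes q) (no ¬r) x = contradiction (Equivalence.from P⇔ (inj₁ q)) ¬p
  []-⊎ P⇔ ¬QR (yes p) (no ¬q) (yes r) x = sym (identityˡ x)
  []-⊎ P⇔ ¬QR (no ¬p) (no ¬q) (yes r) x = contradiction (Equivalence.from P⇔ (inj₂ r)) ¬p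
  []-⊎ P⇔ ¬QR (yes p) (no ¬q) (no ¬r) x = contradiction (Equivalence.to P⇔ p) [ ¬q , ¬r ]′
  []-⊎ P⇔ ¬QR (no ¬p) (no ¬q) (no ¬r) x = sym (identityˡ ε)

  sum-[] : {P : Set p} (p? : Dec P) (t : Fin n → Carrier) → sum (λ i → [ p? ] t i) ≈ [ p? ] sum t
  sum-[] (yes p) t = refl
  sum-[] {n = n} (no ¬p) t = sum-replicate-zero n

  sum-[≟] : ∀ (j : Fin n) (t : Fin n → Carrier) → sum (λ i → [ j ≟ i ] t i) ≈ t j
  sum-[≟] {suc n} zero    t = trans (∙-congˡ (sum-replicate-zero n)) (identityʳ (t zero))
  -- The term at `zero` is `ε`, and `does (suc j ≟ suc i)` reduces to `does (j ≟ i)`, so the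
  -- remaining sum is already the inductive one.
  sum-[≟] {suc n} (suc j) t = trans (identityˡ _) (sum-[≟] j (t ∘ suc))

  sum-↑ : ∀ m {n} (t : Fin (m + n) → Carrier) →
          sum t ≈ sum (λ i → t (i ↑ˡ n)) ∙ sum (λ j → t (m ↑ʳ j))
  sum-↑ zero    t = sym (identityˡ (sum t))
  sum-↑ (suc m) t = trans (∙-congˡ (sum-↑ m (t ∘ suc))) (sym (assoc _ _ _))

  -- `combine` numbers the pairs block by block, one block of length `n` for each `i`, so `sum-↑`
  -- peels off the blocks in turn.
  sum-combine : ∀ m {n} (t : Fin (m * n) → Carrier) →
                sum t ≈ sum {m} (λ i → sum {n} (λ j → t (combine i j)))
  sum-combine zero        t = refl
  sum-combine (suc m) {n} t = trans (sum-↑ n t) (∙-congˡ (sum-combine m (t ∘ (n ↑ʳ_))))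

  -- The enumeration meets the class of `x` exactly once, at index `to x`. The surviving term is
  -- taken at `from (to x)`, which is only equivalent to `x`; hence the congruence demanded of `g`.
  sum-[≈?] : {S : Setoid v ℓ} (h : HasCardinality S n) (g : Setoid.Carrier S → Carrier) →
             (∀ {x y} → Setoid._≈_ S x y → g x ≈ g y) →
             ∀ x → sum (λ i → [ (h ≈? x) (Inverse.from h i) ] g (Inverse.from h i)) ≈ g x
  sum-[≈?] {n = n} {S = S} h g g-cong x = begin
    sum (λ i → [ (h ≈? x) (from i) ] g (from i))
      ≈⟨ sum-cong-≋ {n} (λ i → []-cong (≈⇔≡ i) ((h ≈? x) (from i)) (to x ≟ i) refl) ⟩
    sum (λ i → [ to x ≟ i ] g (from i))
      ≈⟨ sum-[≟] (to x) (g ∘ from) ⟩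
    g (from (to x))
      ≈⟨ g-cong (inverseʳ ≡.refl) ⟩
    g x ∎
    where
    open Inverse h using (to; from; inverseˡ; inverseʳ)
    ≈⇔≡ : ∀ i → Setoid._≈_ S x (from i) ⇔ (to x ≡ i)
    ≈⇔≡ i = mk⇔ (λ eq → inverseˡ eq) (λ eq → Setoid.sym S (inverseʳ (≡.sym eq)))

  foldr-filter-tabulate : {A : Set v} {P : A → Set p} (P? : ∀ x → Dec (P x)) (g : A → Carrier) →
    ∀ {n} (t : Fin n → A) →
    foldr _∙_ ε (map g (filter P? (tabulate t))) ≈ sum (λ i → [ P? (t i) ] g (t i))
  foldr-filter-tabulate P? g {zero}  t = refl
  foldr-filter-tabulate P? g {suc n} t with does (P? (t zero))
  ... | true  = ∙-congˡ (foldr-filter-tabulate P? g (t ∘ suc))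
  ... | false = trans (foldr-filter-tabulate P? g (t ∘ suc)) (sym (identityˡ _))

  foldr-map-const : {A : Set v} (c : Carrier) (xs : List A) →
                    foldr _∙_ ε (map (const c) xs) ≈ length xs ⋆ c
  foldr-map-const c []       = refl
  foldr-map-const c (x ∷ xs) = ∙-congˡ (foldr-map-const c xs)

  -- Sums over neighbourhoods, and their splitting in a product.

  module _ (G : Graph v ℓ e) where

    open Graph G using (V; N; degree; _~?_; enumeration)

    neighbourSum : (V → Carrier) → V → Carrier
    neighbourSum g x = foldr _∙_ ε (map g (N x))

    neighbourSum-sum : ∀ g x → neighbourSum g x ≈
      sum (λ i → [ x ~? Inverse.from enumeration i ] g (Inverse.from enumeration i))
    neighbourSum-sum g x = foldr-filter-tabulate (x ~?_) g (Inverse.from enumeration)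

    neighbourSum-const : ∀ c x → neighbourSum (const c) x ≈ degree x ⋆ c
    neighbourSum-const c x = foldr-map-const c (N x)

  module _ {k} (G : Fin (suc k) → Graph v ℓ e) where

    private
      module P = Graph (□ G)
      module H = Graph (G zero)
      module T = Graph (□ (G ∘ suc))
      module EP = Inverse P.enumeration
      module EH = Inverse H.enumeration
      module ET = Inverse T.enumeration

    open Adjacency G using (□-adjacent)

    -- Written as a double sum over pairs (head, tail), the adjacency bracket splits by `□-adjacent`
    -- into moves of the head and moves of the tail. In each part the bracket for equality of the
    -- unmoved component collapses one of the two sums.
    neighbourSum-□ : (g : P.V → Carrier) → (∀ {x y} → x P.≈ y → g x ≈ g y) → ∀ x →
      neighbourSum (□ G) g x ≈
        neighbourSum (G zero) (λ y → g (∀-cons y (x ∘ suc))) (x zero) ∙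
        neighbourSum (□ (G ∘ suc)) (λ y → g (∀-cons (x zero) y)) (x ∘ suc)
    neighbourSum-□ g g-cong x = begin
      neighbourSum (□ G) g x
        ≈⟨ neighbourSum-sum (□ G) g x ⟩
      sum (λ j → [ x P.~? EP.from j ] g (EP.from j))
        ≈⟨ sum-combine H.order {T.order} (λ j → [ x P.~? EP.from j ] g (EP.from j)) ⟩
      sum (λ (i : Fin H.order) → sum (λ (j : Fin T.order) →
        [ x P.~? EP.from (combine i j) ] g (EP.from (combine i j))))
        ≈⟨ sum-cong-≋ {H.order} (λ i →
             trans (sum-cong-≋ {T.order} (split i)) (∑-distrib-+ (headMoves i) (tailMoves i))) ⟩
      sum (λ i → sum (headMoves i) ∙ sum (tailMoves i))
        ≈⟨ ∑-distrib-+ (sum ∘ headMoves) (sum ∘ tailMoves) ⟩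
      sum (sum ∘ headMoves) ∙ sum (sum ∘ tailMoves)
        ≈⟨ ∙-cong sum-headMoves sum-tailMoves ⟩
      sum (λ i → [ x₀ H.~? EH.from i ] g (∀-cons (EH.from i) xs)) ∙
      sum (λ j → [ xs T.~? ET.from j ] g (∀-cons x₀ (ET.from j)))
        ≈⟨ ∙-cong (neighbourSum-sum (G zero) _ x₀) (neighbourSum-sum (□ (G ∘ suc)) _ xs) ⟨
      neighbourSum (G zero) (λ y → g (∀-cons y xs)) x₀ ∙
      neighbourSum (□ (G ∘ suc)) (λ y → g (∀-cons x₀ y)) xs ∎
      where
      x₀ : H.V
      x₀ = x zero

      xs : T.V
      xs = x ∘ suc

      y : Fin H.order → Fin T.order → P.V
      y i j = ∀-cons (EH.from i) (ET.from j)

      _≟₀_ : Decidable H._≈_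
      _≟₀_ = _≈?_ H.enumeration

      _≟ₛ_ : Decidable T._≈_
      _≟ₛ_ = _≈?_ T.enumeration

      headMoves tailMoves : Fin H.order → Fin T.order → Carrier
      headMoves i j = [ x₀ H.~? EH.from i ] [ xs ≟ₛ ET.from j ] g (y i j)
      tailMoves i j = [ x₀ ≟₀ EH.from i ] [ xs T.~? ET.from j ] g (y i j)

      from-combine : ∀ i j → EP.from (combine i j) P.≈ y i j
      from-combine i j zero =
        EH.from-cong (≡.cong proj₁ (remQuot-combine i j))
      from-combine i j (suc l) =
        ET.from-cong (≡.cong proj₂ (remQuot-combine i j)) l

      ~-from-combine : ∀ i j → (x P.~ EP.from (combine i j)) ⇔ (x P.~ y i j)
      ~-from-combine i j = mk⇔
        (proj₁ P.~-resp-≈ (from-combine i j))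
        (proj₁ P.~-resp-≈ (Setoid.sym P.vertices (from-combine i j)))

      split : ∀ i j → [ x P.~? EP.from (combine i j) ] g (EP.from (combine i j)) ≈
                      headMoves i j ∙ tailMoves i j
      split i j = begin
        [ x P.~? EP.from (combine i j) ] g (EP.from (combine i j))
          ≈⟨ []-cong (~-from-combine i j) (x P.~? _) (x P.~? y i j) (g-cong (from-combine i j)) ⟩
        [ x P.~? y i j ] g (y i j)
          -- The two kinds of move exclude each other: the heads would be both adjacent and equal.
          ≈⟨ []-⊎ □-adjacent (λ { ((adj , _) , (eq , _)) → H.~-irrefl eq adj })
               (x P.~? y i j) (h~? ×-dec t≈?) (h≈? ×-dec t~?) (g (y i j)) ⟩
        [ h~? ×-dec t≈? ] g (y i j) ∙ [ h≈? ×-dec t~? ] g (y i j)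
          ≈⟨ ∙-cong ([]-× h~? t≈? _) ([]-× h≈? t~? _) ⟩
        headMoves i j ∙ tailMoves i j ∎
        where
        h~? = x₀ H.~? EH.from i
        h≈? = x₀ ≟₀ EH.from i
        t~? = xs T.~? ET.from j
        t≈? = xs ≟ₛ ET.from j

      ∀-cons-cong : ∀ {u u′ : H.V} {w w′ : T.V} → u H.≈ u′ → w T.≈ w′ → ∀-cons u w P.≈ ∀-cons u′ w′
      ∀-cons-cong eq eqs zero    = eq
      ∀-cons-cong eq eqs (suc i) = eqs i

      sum-headMoves : sum (sum ∘ headMoves) ≈
                      sum (λ i → [ x₀ H.~? EH.from i ] g (∀-cons (EH.from i) xs))
      sum-headMoves = sum-cong-≋ {H.order} λ i →
        trans (sum-[] (x₀ H.~? EH.from i) (λ j → [ xs ≟ₛ ET.from j ] g (y i j)))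
              ([]-congʳ (x₀ H.~? EH.from i) λ _ →
                sum-[≈?] T.enumeration (λ w → g (∀-cons (EH.from i) w))
                  (λ eq → g-cong (∀-cons-cong (Setoid.refl H.vertices) eq)) xs)

      sum-tailMoves : sum (sum ∘ tailMoves) ≈
                      sum (λ j → [ xs T.~? ET.from j ] g (∀-cons x₀ (ET.from j)))
      sum-tailMoves = trans
        (sum-cong-≋ {H.order} λ i → sum-[] (x₀ ≟₀ EH.from i) (λ j → [ xs T.~? ET.from j ] g (y i j)))
        -- Here the equality bracket concerns the outer index, so the whole inner sum serves as the
        -- function evaluated at `x₀`.
        (sum-[≈?] H.enumeration (λ u → sum (λ j → [ xs T.~? ET.from j ] g (∀-cons u (ET.from j))))
          (λ eq → sum-cong-≋ {T.order} λ j → []-congʳ (xs T.~? ET.from j) λ _ →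
            g-cong (∀-cons-cong eq (Setoid.refl T.vertices)))
          x₀)

open Summation using (neighbourSum)

-- Regularity of the product.

-- A degree is the neighbour sum of the constant 1 in the additive monoid of naturals, so the
-- splitting used for weights also adds up degrees.
□-regular : ∀ {k} (G : Fin k → Graph v ℓ e) (r : Fin k → ℕ) →
            (∀ i → Regular (G i) (r i)) → Regular (□ G) (∑ r)
-- The empty product has one vertex and no edges, so both sides compute to 0.
□-regular {k = zero}  G r reg x = ≡.refl
□-regular {k = suc k} G r reg x = begin
  degree (□ G) x
    ≡⟨ degree-neighbourSum (□ G) x ⟩
  neighbourSum ℕ₊ (□ G) (const 1) x
    ≡⟨ Summation.neighbourSum-□ ℕ₊ G (const 1) (const ≡.refl) x ⟩
  neighbourSum ℕ₊ (G zero) (const 1) (x zero) + neighbourSum ℕ₊ (□ (G ∘ suc)) (const 1) (x ∘ suc)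
    ≡⟨ ≡.cong₂ _+_ (degree-neighbourSum (G zero) (x zero))
                   (degree-neighbourSum (□ (G ∘ suc)) (x ∘ suc)) ⟨
  degree (G zero) (x zero) + degree (□ (G ∘ suc)) (x ∘ suc)
    ≡⟨ ≡.cong₂ _+_ (reg zero (x zero)) (□-regular (G ∘ suc) (r ∘ suc) (reg ∘ suc) (x ∘ suc)) ⟩
  r zero + ∑ (r ∘ suc) ∎
  where
  open ≡.≡-Reasoning
  open Graph using (degree)
  ℕ₊ = +-0-commutativeMonoid

  length-sum : ∀ {A : Set v} (xs : List A) → length xs ≡ foldr _+_ 0 (map (const 1) xs)
  length-sum []       = ≡.refl
  length-sum (x ∷ xs) = ≡.cong suc (length-sum xs)

  degree-neighbourSum : ∀ {ℓ e} (H : Graph v ℓ e) x → degree H x ≡ neighbourSum ℕ₊ H (const 1) x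
  degree-neighbourSum H x = length-sum (Graph.N H x)

-- Neighbour sums of functions of a single coordinate.

module _ (M : CommutativeMonoid a b) where

  open CommutativeMonoid M
  open Summation M using (neighbourSum-□; neighbourSum-const)
  open Mult M using (×-homo-+; ×-congˡ) renaming (_×_ to _⋆_)
  open SetoidReasoning setoid

  -- Stated without subtraction, so that it holds in a monoid.
  neighbourSum-coordinate :
    ∀ {k} (G : Fin k → Graph v ℓ e) (r : Fin k → ℕ) → (∀ i → Regular (G i) (r i)) →
    ∀ i (g : Graph.V (G i) → Carrier) → (∀ {x y} → Graph._≈_ (G i) x y → g x ≈ g y) → ∀ x →
    neighbourSum M (□ G) (λ y → g (y i)) x ∙ (r i ⋆ g (x i)) ≈
    neighbourSum M (G i) g (x i) ∙ (∑ r ⋆ g (x i))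
  neighbourSum-coordinate {k = suc k} G r reg zero g g-cong x = begin
    neighbourSum M (□ G) (λ y → g (y zero)) x ∙ (r zero ⋆ c)
      ≈⟨ ∙-congʳ (neighbourSum-□ G _ (λ eq → g-cong (eq zero)) x) ⟩
    (w ∙ neighbourSum M (□ (G ∘ suc)) (const c) (x ∘ suc)) ∙ (r zero ⋆ c)
      -- Moves in the tail keep coordinate `zero`, so each of the `∑ (r ∘ suc)` of them contributes
      -- `c`.
      ≈⟨ ∙-congʳ (∙-congˡ (trans (neighbourSum-const (□ (G ∘ suc)) c (x ∘ suc))
           (×-congˡ (□-regular (G ∘ suc) (r ∘ suc) (reg ∘ suc) (x ∘ suc))))) ⟩
    (w ∙ (∑ (r ∘ suc) ⋆ c)) ∙ (r zero ⋆ c)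
      ≈⟨ assoc _ _ _ ⟩
    w ∙ ((∑ (r ∘ suc) ⋆ c) ∙ (r zero ⋆ c))
      ≈⟨ ∙-congˡ (comm _ _) ⟩
    w ∙ ((r zero ⋆ c) ∙ (∑ (r ∘ suc) ⋆ c))
      ≈⟨ ∙-congˡ (×-homo-+ c (r zero) (∑ (r ∘ suc))) ⟨
    w ∙ (∑ r ⋆ c) ∎
    where
    c = g (x zero)
    w = neighbourSum M (G zero) g (x zero)
  neighbourSum-coordinate {k = suc k} G r reg (suc i) g g-cong x = begin
    neighbourSum M (□ G) (λ y → g (y (suc i))) x ∙ (r (suc i) ⋆ c)
      ≈⟨ ∙-congʳ (neighbourSum-□ G _ (λ eq → g-cong (eq (suc i))) x) ⟩
    (neighbourSum M (G zero) (const c) (x zero) ∙ W) ∙ (r (suc i) ⋆ c)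
      ≈⟨ assoc _ _ _ ⟩
    neighbourSum M (G zero) (const c) (x zero) ∙ (W ∙ (r (suc i) ⋆ c))
      -- The `r zero` moves of the head each contribute `c`; the moves of the tail are handled by
      -- induction.
      ≈⟨ ∙-cong (trans (neighbourSum-const (G zero) c (x zero)) (×-congˡ (reg zero (x zero))))
                (neighbourSum-coordinate (G ∘ suc) (r ∘ suc) (reg ∘ suc) i g g-cong (x ∘ suc)) ⟩
    (r zero ⋆ c) ∙ (w ∙ (∑ (r ∘ suc) ⋆ c))
      ≈⟨ x∙yz≈y∙xz _ _ _ ⟩
    w ∙ ((r zero ⋆ c) ∙ (∑ (r ∘ suc) ⋆ c))
      ≈⟨ ∙-congˡ (×-homo-+ c (r zero) (∑ (r ∘ suc))) ⟨
    w ∙ (∑ r ⋆ c) ∎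
    where
    open CommutativeSemigroupProperties commutativeSemigroup using (x∙yz≈y∙xz)
    c = g (x (suc i))
    w = neighbourSum M (G (suc i)) g (x (suc i))
    W = neighbourSum M (□ (G ∘ suc)) (λ y → g (y i)) (x ∘ suc)

-- Makes the truncated subtraction in `∑ r ∸ r i` exact.
r≤∑r : ∀ {k} (r : Fin k → ℕ) i → r i ≤ ∑ r
r≤∑r r zero    = m≤m+n (r zero) _
r≤∑r r (suc i) = m≤n⇒m≤o+n (r zero) (r≤∑r (r ∘ suc) i)

-- Multiples in a finite Abelian group.

module _ (A : AbelianGroup a b) where

  open AbelianGroup A
  open Mult commutativeMonoid using (×-congʳ; ×-congˡ; ×-assocˡ) renaming (_×_ to _⋆_)
  open GroupProperties group using (∙-cancelʳ; identityˡ-unique)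
  open SetoidReasoning setoid

  -- Translation by x permutes A, so the sum s of all elements satisfies
  -- s ≈ s + n x.
  order-annihilates : HasOrder A n → Annihilates A n
  order-annihilates {n = n} h x = identityˡ-unique (n ⋆ x) (sum from) (begin
    (n ⋆ x) ∙ sum from
      ≈⟨ ∙-congʳ (sum-replicate n) ⟨
    sum {n} (const x) ∙ sum from
      ≈⟨ ∑-distrib-+ (const x) from ⟨
    sum (λ i → x ∙ from i)
      ≈⟨ sum-cong-≋ {n} (λ i → H.inverseʳ ≡.refl) ⟨
    sum (λ i → from (shift x i))
      ≈⟨ sum-permute from (permutation (shift x) (shift (x ⁻¹)) there back) ⟨
    sum from ∎)
    where
    open module H = Inverse h using (to; from)
    open Sum commutativeMonoid
      using (sum; sum-cong-≋; sum-replicate; ∑-distrib-+; sum-permute)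

    shift : Carrier → Fin n → Fin n
    shift y i = to (y ∙ from i)

    shift-shift : ∀ y z → y ∙ z ≈ ε → ∀ i → shift y (shift z i) ≡ i
    shift-shift y z yz≈ε i = H.inverseˡ (begin
      y ∙ from (to (z ∙ from i)) ≈⟨ ∙-congˡ (H.inverseʳ ≡.refl) ⟩
      y ∙ (z ∙ from i)           ≈⟨ assoc _ _ _ ⟨
      (y ∙ z) ∙ from i           ≈⟨ ∙-congʳ yz≈ε ⟩
      ε ∙ from i                 ≈⟨ identityˡ _ ⟩
      from i                     ∎)

    there : ∀ i → shift x (shift (x ⁻¹) i) ≡ i
    there = shift-shift x (x ⁻¹) (inverseʳ x)

    back : ∀ i → shift (x ⁻¹) (shift x i) ≡ i
    back = shift-shift (x ⁻¹) x (inverseˡ x)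

  annihilates-∣ : ∀ {m o} → Annihilates A m → m ∣ o → Annihilates A o
  annihilates-∣ {m} {o} ann (divides c o≡c*m) x = begin
    o ⋆ x       ≈⟨ ×-congˡ (≡.trans o≡c*m (*-comm c m)) ⟩
    (m * c) ⋆ x ≈⟨ ×-assocˡ x m c ⟨
    m ⋆ (c ⋆ x) ≈⟨ ann (c ⋆ x) ⟩
    ε           ∎

  -- Bézout gives `c` with `c * m` congruent to 1 or to -1 modulo `n`. As `n` annihilates `A`,
  -- multiplication by `c` undoes multiplication by `m` up to sign; over the naturals the two signs
  -- are separate cases.
  ⋆-cancel-coprime : ∀ m → Annihilates A n → gcd m n ≡ 1 →
                     ∀ {x y} → m ⋆ x ≈ m ⋆ y → x ≈ y
  ⋆-cancel-coprime {n = n} m ann coprime {x} {y} mx≈my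
    with Bézout.identity (≡.subst (GCD m n) coprime (gcd-GCD m n))
  ... | Bézout.+- c d 1+dn≡cm = begin
    x           ≈⟨ recover x ⟩
    c ⋆ (m ⋆ x) ≈⟨ ×-congʳ c mx≈my ⟩
    c ⋆ (m ⋆ y) ≈⟨ recover y ⟨
    y           ∎
    where
    recover : ∀ z → z ≈ c ⋆ (m ⋆ z)
    recover z = begin
      z                 ≈⟨ identityʳ z ⟨
      z ∙ ε             ≈⟨ ∙-congˡ (annihilates-∣ ann (divides d ≡.refl) z) ⟨
      -- The left side is `(1 + d * n) ⋆ z` by definition, so the Bézout equation applies directly.
      z ∙ ((d * n) ⋆ z) ≈⟨ ×-congˡ 1+dn≡cm ⟩
      (c * m) ⋆ z       ≈⟨ ×-assocˡ z c m ⟨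
      c ⋆ (m ⋆ z)       ∎
  -- With the sign -1, both `x` and `y` are inverse to the same element `c ⋆ (m ⋆ x)`.
  ... | Bézout.-+ c d 1+cm≡dn = ∙-cancelʳ (c ⋆ (m ⋆ x)) x y (begin
    x ∙ (c ⋆ (m ⋆ x)) ≈⟨ vanish x ⟩
    ε                 ≈⟨ vanish y ⟨
    y ∙ (c ⋆ (m ⋆ y)) ≈⟨ ∙-congˡ (×-congʳ c mx≈my) ⟨
    y ∙ (c ⋆ (m ⋆ x)) ∎)
    where
    vanish : ∀ z → z ∙ (c ⋆ (m ⋆ z)) ≈ ε
    vanish z = begin
      z ∙ (c ⋆ (m ⋆ z)) ≈⟨ ∙-congˡ (×-assocˡ z c m) ⟩
      z ∙ ((c * m) ⋆ z) ≈⟨ ×-congˡ 1+cm≡dn ⟩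
      (d * n) ⋆ z       ≈⟨ annihilates-∣ ann (divides d ≡.refl) z ⟩
      ε                 ∎

-- What each of the three conditions gives for a single factor.

module _ (G : Graph v ℓ e) (A : AbelianGroup a b) where

  open Graph G using (V) renaming (_≈_ to _≈ᵛ_)
  open AbelianGroup A
  open Mult commutativeMonoid using (×-homo-+; ×-congˡ) renaming (_×_ to _⋆_)
  open GroupProperties group using (∙-cancelˡ)
  open SetoidReasoning setoid

  -- When `m` counts the neighbours in the product that keep this coordinate, this is one component
  -- of the product weight.
  shiftedWeight : Labelling G A → ℕ → V → Carrier
  shiftedWeight f m x = weight G A f x ∙ (m ⋆ Bijection.to f x)

  -- The common consequence of (a), (b) and (c), so that the assembly of the factors needs no case
  -- distinction.
  HasInjectiveShiftedWeight : ℕ → Set (v ⊔ ℓ ⊔ a ⊔ b)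
  HasInjectiveShiftedWeight m = ∃[ f ] Injective _≈ᵛ_ _≈_ (shiftedWeight f m)

  -- The constant weight cancels, which leaves equal `m`-fold labels.
  magic⇒injective : ∀ m n → Annihilates A n → gcd m n ≡ 1 →
                    DistanceMagic G A → HasInjectiveShiftedWeight m
  magic⇒injective m n ann coprime (f , magic) = f , λ {x} {y} eq →
    Bijection.injective f (⋆-cancel-coprime A m ann coprime
      (∙-cancelˡ (weight G A f x) _ _ (trans eq (∙-congʳ (magic y x)))))

  -- The shift vanishes, so the shifted weight is the weight itself.
  antimagic⇒injective : ∀ m → Annihilates A m →
                        DistanceAntimagic G A → HasInjectiveShiftedWeight m
  antimagic⇒injective m ann (f , antimagic) = f , λ {x} {y} eq →
    antimagic (trans (sym (unshift x)) (trans eq (unshift y)))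
    where
    unshift : ∀ x → shiftedWeight f m x ≈ weight G A f x
    unshift x = trans (∙-congˡ (ann (Bijection.to f x))) (identityʳ _)

  -- Weight and shift are both multiples of the label and combine to its `(r + m)`-fold.
  balanced⇒injective : ∀ r m n → Annihilates A n → gcd (r + m) n ≡ 1 →
                       HasBalancedLabelling G A r → HasInjectiveShiftedWeight m
  balanced⇒injective r m n ann coprime (f , balanced) = f , λ {x} {y} eq →
    Bijection.injective f (⋆-cancel-coprime A (r + m) ann coprime
      (trans (sym (collect x)) (trans eq (collect y))))
    where
    collect : ∀ x → shiftedWeight f m x ≈ (r + m) ⋆ Bijection.to f x
    collect x = trans (∙-congʳ (balanced x)) (sym (×-homo-+ _ r m))

-- The product labelling and its weights.

module _ {k} (G : Fin k → Graph v ℓ e) (A : Fin k → AbelianGroup a b) where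

  private
    module A i = AbelianGroup (A i)

  ∏-labelling : (∀ i → Labelling (G i) (A i)) → Labelling (□ G) (∏ᴳ A)
  ∏-labelling f = record
    { to        = λ x i → Bijection.to (f i) (x i)
    ; cong      = λ eq i → Bijection.cong (f i) (eq i)
    ; bijective =
        (λ eq i → Bijection.injective (f i) (eq i))
      , λ y → (λ i → proj₁ (Bijection.surjective (f i) (y i)))
            , λ eq i → proj₂ (Bijection.surjective (f i) (y i)) (eq i)
    }

  module _ (f : ∀ i → Labelling (G i) (A i)) where

    -- The operation of `∏ᴳ A` is pointwise, so taking component `i` commutes with the fold. This
    -- moves the computation into `A i`, where `neighbourSum-coordinate` applies.
    weight-coordinate : ∀ x i →
      weight (□ G) (∏ᴳ A) (∏-labelling f) x i ≡
      neighbourSum (A.commutativeMonoid i) (□ G) (λ y → Bijection.to (f i) (y i)) x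
    weight-coordinate x i = foldr-coordinate (Graph.N (□ G) x)
      where
      foldr-coordinate : ∀ ys →
        foldr (AbelianGroup._∙_ (∏ᴳ A)) (AbelianGroup.ε (∏ᴳ A))
          (map (Bijection.to (∏-labelling f)) ys) i ≡
        foldr (A._∙_ i) (A.ε i) (map (λ y → Bijection.to (f i) (y i)) ys)
      foldr-coordinate []       = ≡.refl
      foldr-coordinate (y ∷ ys) = ≡.cong (A._∙_ i _) (foldr-coordinate ys)

    -- Adding `r i ⋆ c` to both sides brings the claim to the subtraction-free form of
    -- `neighbourSum-coordinate`; in a group the added term can be cancelled again.
    weight-∏-labelling : (r : Fin k → ℕ) → (∀ i → Regular (G i) (r i)) → ∀ x i →
      A._≈_ i (weight (□ G) (∏ᴳ A) (∏-labelling f) x i)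
              (shiftedWeight (G i) (A i) (f i) (∑ r ∸ r i) (x i))
    weight-∏-labelling r reg x i = ∙-cancelʳ (r i ⋆ c) _ _ (begin
      weight (□ G) (∏ᴳ A) (∏-labelling f) x i ∙ (r i ⋆ c)
        ≡⟨ ≡.cong (_∙ (r i ⋆ c)) (weight-coordinate x i) ⟩
      neighbourSum commutativeMonoid (□ G) (λ y → Bijection.to (f i) (y i)) x ∙ (r i ⋆ c)
        ≈⟨ neighbourSum-coordinate commutativeMonoid G r reg i
             (Bijection.to (f i)) (Bijection.cong (f i)) x ⟩
      w ∙ (∑ r ⋆ c)
        ≈⟨ ∙-congˡ (×-congˡ (m∸n+n≡m (r≤∑r r i))) ⟨
      w ∙ ((∑ r ∸ r i + r i) ⋆ c)
        ≈⟨ ∙-congˡ (×-homo-+ c (∑ r ∸ r i) (r i)) ⟩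
      w ∙ (((∑ r ∸ r i) ⋆ c) ∙ (r i ⋆ c))
        ≈⟨ assoc _ _ _ ⟨
      (w ∙ ((∑ r ∸ r i) ⋆ c)) ∙ (r i ⋆ c) ∎)
      where
      open AbelianGroup (A i)
      open Mult commutativeMonoid using (×-homo-+; ×-congˡ) renaming (_×_ to _⋆_)
      open GroupProperties group using (∙-cancelʳ)
      open SetoidReasoning setoid
      c = Bijection.to (f i) (x i)
      w = weight (G i) (A i) (f i) (x i)

  -- Component `i` of the weight depends only on `x i`, and equality is pointwise both in `□ G` and
  -- in `∏ᴳ A`, so injectivity can be checked one coordinate at a time.
  injective⇒antimagic : (r : Fin k → ℕ) → (∀ i → Regular (G i) (r i)) →
    (∀ i → HasInjectiveShiftedWeight (G i) (A i) (∑ r ∸ r i)) →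
    DistanceAntimagic (□ G) (∏ᴳ A)
  injective⇒antimagic r reg inj = ∏-labelling f , λ {x} {y} eq i →
    proj₂ (inj i) (A.trans i (A.sym i (weight-∏-labelling f r reg x i))
                  (A.trans i (eq i) (weight-∏-labelling f r reg y i)))
    where
    f : ∀ i → Labelling (G i) (A i)
    f i = proj₁ (inj i)

mainTheorem7 : ∀ {v ℓ e a b} (k : ℕ)
    (G : Fin k → Graph v ℓ e) (A : Fin k → AbelianGroup a b)
    (n r : Fin k → ℕ) →
    (∀ i → Graph.order (G i) ≡ n i) →
    (∀ i → 2 ≤ n i) →
    (∀ i → Regular (G i) (r i)) →
    (∀ i → HasOrder (A i) (n i)) →
    (I J L : Subset k) → IsPartition I J L →
    (∀ i → i ∈ I → DistanceMagic (G i) (A i) × gcd (∑ r ∸ r i) (n i) ≡ 1) →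
    (∀ j → j ∈ J → DistanceAntimagic (G j) (A j) × (∃[ m ] IsExp (A j) m × m ∣ (∑ r ∸ r j))) →
    (∀ l → l ∈ L → HasBalancedLabelling (G l) (A l) (r l) × gcd (∑ r) (n l) ≡ 1) →
    DistanceAntimagic (□ G) (∏ᴳ A)
mainTheorem7 k G A n r _ _ reg ord I J L partition hI hJ hL =
  injective⇒antimagic G A r reg (λ i → byPart i (IsPartition.cover partition i))
  where
  ann : ∀ i → Annihilates (A i) (n i)
  ann i = order-annihilates (A i) (ord i)

  byPart : ∀ i → i ∈ I ⊎ i ∈ J ⊎ i ∈ L → HasInjectiveShiftedWeight (G i) (A i) (∑ r ∸ r i)
  byPart i (inj₁ i∈I) =
    let magic , coprime = hI i i∈I
    in magic⇒injective (G i) (A i) (∑ r ∸ r i) (n i) (ann i) coprime magic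
  byPart i (inj₂ (inj₁ i∈J)) =
    let antimagic , m , ((_ , m-ann) , _) , m∣ = hJ i i∈J
    -- The exponent annihilates `A i`, hence so does its multiple `∑ r ∸ r i`.
    in antimagic⇒injective (G i) (A i) (∑ r ∸ r i) (annihilates-∣ (A i) m-ann m∣) antimagic
  byPart i (inj₂ (inj₂ i∈L)) =
    let balanced , coprime = hL i i∈L
    in balanced⇒injective (G i) (A i) (r i) (∑ r ∸ r i) (n i) (ann i)
         -- The combined multiplier `r i + (∑ r ∸ r i)` is `∑ r`, the number that (c) makes coprime
         -- to `n i`.
         (≡.subst (λ m → gcd m (n i) ≡ 1) (≡.sym (m+[n∸m]≡n (r≤∑r r i))) coprime) balanced
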